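{- Let $\mathcal{P}$ be a regular $n$-polytope with automorphism group $W=\langle s_0,\dots,s_{n-1}\rangle$. Let $\mathcal{Q}=\mathcal{P}/N$ be a quotient of $\mathcal{P}$ admitting the flag action of $W$, with base flag $\Psi$ chosen so that $N$ is the stabilizer of $\Psi$ in $W$. Let $\mathcal{R}$ be a regular $d$-polytope with $\mathrm{Aut}(\mathcal{R})=\langle\rho_0,\dots,\rho_{d-1}\rangle$, and let $\phi:\mathrm{Aut}(\mathcal{R})\to\mathrm{Aut}(\mathcal{Q})$ be a group isomorphism. For each $i$ let $\nu_i\in W$ satisfy $\Psi^{\nu_i}=\Psi(\rho_i\phi)$, let $V=\langle\nu_0,\dots,\nu_{d-1}\rangle$, and define $\psi$ from words in the $\rho_i$ to $W$ by $(\rho_{i_1}\cdots\rho_{i_k})\psi=\nu_{i_k}\cdots\nu_{i_1}$. Let $T$ be a right transversal of $V$ in $W$ such that for every $\mu\in T$, if $N\cap V\mu\neq\emptyset$ then $\mu\in N$. Then \[N=\bigcup_{\mu\in N\cap T}\{(w\psi)\mu : w \text{ a word in the } \rho_i \text{ with } w=1 \text{ in } \mathrm{Aut}(\mathcal{R})\}.\]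
   Context: Abstract polytopes are graded posets with least and greatest faces, all flags of equal length, strongly connected, satisfying the diamond condition; a regular polytope has flag-transitive automorphism group, which is a string C-group generated by involutions. The flag action of $W$ on the flags of $\mathcal{Q}$ is the right action in which $s_i$ sends a flag $\Phi$ to the unique flag $\Phi^{s_i}$ differing from $\Phi$ only in its face of rank $i$ (assumed well defined), with $\Phi^{vw}=(\Phi^{v})^{w}$. Automorphisms act on flags on the right, written $\Psi\alpha$, and commute with the flag action. A right transversal of $V$ in $W$ is a set containing exactly one element of each right coset $V\mu$.
   Formalization: Words in the ρ_i may also contain inverses ρ_i^{ -1}, sent by ψ to ν_i^{ -1}; with positive words only the identity can fail when some ν_i has infinite order, and for ν_i of finite order both readings give the same set. -}

module Defs where

open import Algebra.Bundles using (Group)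
open import Data.Fin.Base as Fin using (Fin; zero; suc; toℕ; fromℕ; inject₁)
open import Data.Fin.Induction using (<-weakInduction)
import Data.Fin.Properties as Finₚ
open import Data.List.Base using (List; []; _∷_)
open import Data.Nat.Base as ℕ using (ℕ)
import Data.Nat.Properties as ℕₚ
open import Data.Product.Base using (Σ; ∃; ∃₂; _×_; _,_; proj₁; proj₂)
open import Data.Sum.Base using (_⊎_; inj₁; inj₂)
open import Level using (Level; _⊔_) renaming (suc to lsuc)
open import Relation.Binary.Bundles using (Poset)
open import Relation.Binary.Construct.Closure.Equivalence using (EqClosure)
open import Relation.Binary.Core using (Rel)
open import Relation.Binary.Definitions using (Maximum; Minimum)
open import Relation.Binary.Morphism.Structures using (IsOrderIsomorphism)
import Relation.Binary.Morphism.Construct.Composition as Comp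
import Relation.Binary.Morphism.Construct.Identity as Id
import Relation.Binary.Properties.Poset as PosetProperties
open import Relation.Binary.PropositionalEquality.Core as ≡ using (_≡_; _≢_)
open import Relation.Nullary.Negation.Core using (¬_; contradiction)
open import Relation.Unary using (Pred; _∈_)

private
  variable
    a b c ℓ ℓ₁ ℓ₂ p : Level
    n k : ℕ

------------------------------------------------------------------------
-- Subgroups, cosets and words

record Subgroup (G : Group c ℓ) (p : Level) : Set (c ⊔ ℓ ⊔ lsuc p) where
  open Group G
  field
    member  : Pred Carrier p
    resp-≈  : ∀ {x y} → x ≈ y → x ∈ member → y ∈ member
    ε-mem   : ε ∈ member
    ∙-mem   : ∀ {x y} → x ∈ member → y ∈ member → x ∙ y ∈ member
    ⁻¹-mem  : ∀ {x} → x ∈ member → x ⁻¹ ∈ member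

module _ (G : Group c ℓ) where
  open Group G

  -- The subgroup generated by a finite family.
  data ⟨_⟩ (g : Fin k → Carrier) : Pred Carrier (c ⊔ ℓ) where
    gen  : ∀ i → ⟨ g ⟩ (g i)
    unit : ⟨ g ⟩ ε
    mul  : ∀ {x y} → ⟨ g ⟩ x → ⟨ g ⟩ y → ⟨ g ⟩ (x ∙ y)
    inv  : ∀ {x} → ⟨ g ⟩ x → ⟨ g ⟩ (x ⁻¹)
    resp : ∀ {x y} → x ≈ y → ⟨ g ⟩ x → ⟨ g ⟩ y

  RightCoset : Pred Carrier p → Carrier → Pred Carrier (c ⊔ ℓ ⊔ p)
  RightCoset V μ x = ∃ λ v → v ∈ V × x ≈ v ∙ μ

  record IsRightTransversal (V : Pred Carrier a) (T : Pred Carrier b)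
         : Set (c ⊔ ℓ ⊔ a ⊔ b) where
    field
      resp-≈ : ∀ {x y} → x ≈ y → x ∈ T → y ∈ T
      meets  : ∀ μ → ∃ λ x → x ∈ T × x ∈ RightCoset V μ
      unique : ∀ μ {x y} → x ∈ T → y ∈ T →
               x ∈ RightCoset V μ → y ∈ RightCoset V μ → x ≈ y

-- Group words: letters are the generators and their formal inverses.  Inverses
-- matter even over involutions, since a word may be evaluated at elements of
-- another group (of infinite order, say) lifting those involutions.
data Letter (k : ℕ) : Set where
  _⁺ _⁻ : Fin k → Letter k

Word : ℕ → Set
Word k = List (Letter k)

module _ (G : Group c ℓ) (g : Fin k → Group.Carrier G) where
  open Group G

  letter : Letter k → Carrier
  letter (i ⁺) = g i
  letter (i ⁻) = g i ⁻¹

  eval : Word k → Carrier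
  eval []      = ε
  eval (l ∷ w) = letter l ∙ eval w

  -- Evaluation with the order of the letters reversed.
  evalᵒᵖ : Word k → Carrier
  evalᵒᵖ []      = ε
  evalᵒᵖ (l ∷ w) = evalᵒᵖ w ∙ letter l

------------------------------------------------------------------------
-- Automorphisms of a poset, acting on the right

record Automorphism (P : Poset c ℓ₁ ℓ₂) : Set (c ⊔ ℓ₁ ⊔ ℓ₂) where
  open Poset P
  field
    to                 : Carrier → Carrier
    isOrderIsomorphism : IsOrderIsomorphism _≈_ _≈_ _≤_ _≤_ to
  open IsOrderIsomorphism isOrderIsomorphism public
    using (cong; mono; injective; cancel; surjective)

infixl 8 _·_
_·_ : {P : Poset c ℓ₁ ℓ₂} → Poset.Carrier P → Automorphism P → Poset.Carrier P
x · α = Automorphism.to α x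

module _ (P : Poset c ℓ₁ ℓ₂) where
  open Poset P
  open Automorphism

  private
    from : Automorphism P → Carrier → Carrier
    from α y = proj₁ (surjective α y)

    to-from : ∀ α y → from α y · α ≈ y
    to-from α y = proj₂ (surjective α y) Eq.refl

    from-to : ∀ α x → from α (x · α) ≈ x
    from-to α x = injective α (to-from α (x · α))

    id-aut : Automorphism P
    id-aut = record { isOrderIsomorphism = Id.isOrderIsomorphism _≈_ _≤_ Eq.refl }

    comp : Automorphism P → Automorphism P → Automorphism P
    comp α β = record
      { isOrderIsomorphism = Comp.isOrderIsomorphism Eq.trans
          (isOrderIsomorphism α) (isOrderIsomorphism β) }

    inverse : Automorphism P → Automorphism P
    inverse α = record
      { to = from α
      ; isOrderIsomorphism = record
        { isOrderMonomorphism = record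
          { isOrderHomomorphism = record
            { cong = λ {x} {y} x≈y → injective α
                (Eq.trans (to-from α x) (Eq.trans x≈y (Eq.sym (to-from α y))))
            ; mono = λ {x} {y} x≤y → cancel α
                (trans (reflexive (to-from α x))
                  (trans x≤y (reflexive (Eq.sym (to-from α y)))))
            }
          ; injective = λ {x} {y} e →
              Eq.trans (Eq.sym (to-from α x)) (Eq.trans (cong α e) (to-from α y))
          ; cancel = λ {x} {y} e →
              trans (reflexive (Eq.sym (to-from α x)))
                (trans (mono α e) (reflexive (to-from α y)))
          }
        ; surjective = λ x → x · α , λ {z} z≈ →
            injective α (Eq.trans (to-from α z) z≈)
        }
      }

  -- The product α ∙ β is "first α, then β", so that x · (α ∙ β) = (x · α) · β.
  Aut : Group (c ⊔ ℓ₁ ⊔ ℓ₂) (c ⊔ ℓ₁)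
  Aut = record
    { Carrier = Automorphism P
    ; _≈_ = λ α β → ∀ x → x · α ≈ x · β
    ; _∙_ = comp
    ; ε   = id-aut
    ; _⁻¹ = inverse
    ; isGroup = record
      { isMonoid = record
        { isSemigroup = record
          { isMagma = record
            { isEquivalence = record
              { refl  = λ _ → Eq.refl
              ; sym   = λ e x → Eq.sym (e x)
              ; trans = λ e f x → Eq.trans (e x) (f x)
              }
            ; ∙-cong = λ {_} {α′} {β} e f x → Eq.trans (cong β (e x)) (f (x · α′))
            }
          ; assoc = λ _ _ _ _ → Eq.refl
          }
        ; identity = (λ _ _ → Eq.refl) , (λ _ _ → Eq.refl)
        }
      ; inverse = to-from , from-to
      ; ⁻¹-cong = λ {α} {β} e x → injective α
          (Eq.trans (to-from α x)
            (Eq.trans (Eq.sym (to-from β x)) (Eq.sym (e (from β x)))))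
      }
    }

------------------------------------------------------------------------
-- Graded posets and flags

-- Ranks are shifted by one: a face of rank r ∈ {-1, …, n} has `rank` equal
-- to r + 1.  The field `rank-strict` says (positively) that `rank` is strictly
-- monotone, and `graded` that no rank is skipped between comparable faces;
-- together they say that all maximal chains have exactly n + 2 members, one of
-- each rank.
record GradedPoset (n : ℕ) (c ℓ₁ ℓ₂ : Level) : Set (lsuc (c ⊔ ℓ₁ ⊔ ℓ₂)) where
  field
    poset : Poset c ℓ₁ ℓ₂
  open Poset poset public
  field
    rank        : Carrier → Fin (2 ℕ.+ n)
    rank-mono   : ∀ {x y} → x ≤ y → rank x Fin.≤ rank y
    rank-strict : ∀ {x y} → x ≤ y → rank x ≡ rank y → x ≈ y
    ⊥ ⊤         : Carrier
    minimum     : Minimum _≤_ ⊥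
    maximum     : Maximum _≤_ ⊤
    rank-⊥      : rank ⊥ ≡ zero
    rank-⊤      : rank ⊤ ≡ fromℕ (ℕ.suc n)
    graded      : ∀ {x y} → x ≤ y → ∀ j → rank x Fin.≤ j → j Fin.≤ rank y →
                  ∃ λ z → rank z ≡ j × x ≤ z × z ≤ y

  open PosetProperties poset public using (_<_)

  AutGroup : Group (c ⊔ ℓ₁ ⊔ ℓ₂) (c ⊔ ℓ₁)
  AutGroup = Aut poset

  rank-cong : ∀ {x y} → x ≈ y → rank x ≡ rank y
  rank-cong x≈y = Finₚ.≤-antisym (rank-mono (reflexive x≈y))
                                 (rank-mono (reflexive (Eq.sym x≈y)))

  private
    rank-≤ : ∀ α x → rank x Fin.≤ rank (x · α)
    rank-≤ α x = <-weakInduction Goal (λ _ _ → ℕ.z≤n) step (rank x) x ≡.refl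
      where
      open Automorphism α
      Goal : Fin (2 ℕ.+ n) → Set _
      Goal j = ∀ x → rank x ≡ j → j Fin.≤ rank (to x)

      step : ∀ j → Goal (inject₁ j) → Goal (suc j)
      step j ih x rx = ℕₚ.≤-<-trans
        (≡.subst (ℕ._≤ toℕ (rank (to z))) (Finₚ.toℕ-inject₁ j) (ih z rz))
        (ℕₚ.≤∧≢⇒< (rank-mono (mono z≤x)) (λ e → z≉x (injective
          (rank-strict (mono z≤x) (Finₚ.toℕ-injective e)))))
        where
        below : ∃ λ z → rank z ≡ inject₁ j × ⊥ ≤ z × z ≤ x
        below = graded (minimum x) (inject₁ j)
          (≡.subst (Fin._≤ inject₁ j) (≡.sym rank-⊥) ℕ.z≤n)
          (≡.subst (inject₁ j Fin.≤_) (≡.sym rx)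
            (ℕₚ.<⇒≤ (Finₚ.≤̄⇒inject₁< Finₚ.≤-refl)))
        z   = proj₁ below
        rz  = proj₁ (proj₂ below)
        z≤x = proj₂ (proj₂ (proj₂ below))
        z≉x : ¬ z ≈ x
        z≉x z≈x = Finₚ.<⇒≢ (Finₚ.≤̄⇒inject₁< (Finₚ.≤-refl {x = j}))
          (≡.trans (≡.sym rz) (≡.trans (rank-cong z≈x) rx))

  rank-· : ∀ α x → rank (x · α) ≡ rank x
  rank-· α x = Finₚ.≤-antisym
    (≡.subst (rank (x · α) Fin.≤_)
      (rank-cong (Group.inverseʳ AutGroup α x))
      (rank-≤ (Group._⁻¹ AutGroup α) (x · α)))
    (rank-≤ α x)

module _ (P : GradedPoset n c ℓ₁ ℓ₂) where
  open GradedPoset P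

  -- A flag (maximal chain), listed by rank.
  record Flag : Set (c ⊔ ℓ₂) where
    field
      face      : Fin (2 ℕ.+ n) → Carrier
      rank-face : ∀ j → rank (face j) ≡ j
      face-mono : ∀ {i j} → i Fin.≤ j → face i ≤ face j

    maximal : ∀ x → (∀ j → x ≤ face j ⊎ face j ≤ x) → x ≈ face (rank x)
    maximal x comparable with comparable (rank x)
    ... | inj₁ x≤f = rank-strict x≤f (≡.sym (rank-face (rank x)))
    ... | inj₂ f≤x = Eq.sym (rank-strict f≤x (rank-face (rank x)))

-- The position in a flag of its face of rank i.
proper : Fin n → Fin (2 ℕ.+ n)
proper i = suc (inject₁ i)

module _ {P : GradedPoset n c ℓ₁ ℓ₂} where
  open GradedPoset P
  open Flag

  infix 4 _≈ᶠ_
  _≈ᶠ_ : Rel (Flag P) ℓ₁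
  Φ ≈ᶠ Φ′ = ∀ j → face Φ j ≈ face Φ′ j

  infixl 8 _·ᶠ_
  _·ᶠ_ : Flag P → Automorphism poset → Flag P
  Φ ·ᶠ α = record
    { face      = λ j → face Φ j · α
    ; rank-face = λ j → ≡.trans (rank-· α (face Φ j)) (rank-face Φ j)
    ; face-mono = λ i≤j → Automorphism.mono α (face-mono Φ i≤j)
    }

  AgreeOff : Fin n → Rel (Flag P) ℓ₁
  AgreeOff i Φ Φ′ = ∀ j → j ≢ proper i → face Φ j ≈ face Φ′ j

  DifferOnlyAt : Fin n → Rel (Flag P) ℓ₁
  DifferOnlyAt i Φ Φ′ =
    AgreeOff i Φ Φ′ × ¬ (face Φ (proper i) ≈ face Φ′ (proper i))

------------------------------------------------------------------------
-- Abstract polytopes and regular polytopes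

record IsPolytope (P : GradedPoset n c ℓ₁ ℓ₂) : Set (c ⊔ ℓ₁ ⊔ ℓ₂) where
  open GradedPoset P

  StrictlyBetween : Carrier → Carrier → Pred Carrier (ℓ₁ ⊔ ℓ₂)
  StrictlyBetween x y z = x < z × z < y

  field
    -- Every section y / x of rank at least 2 is connected; the rank of the
    -- section is rank y - rank x - 1.
    stronglyConnected :
      ∀ {x y} → x ≤ y → 3 ℕ.+ toℕ (rank x) ℕ.≤ toℕ (rank y) →
      (u v : ∃ (StrictlyBetween x y)) →
      EqClosure (λ u v → proj₁ u ≤ proj₁ v) u v
    diamond :
      ∀ {x y} → x ≤ y → toℕ (rank y) ≡ 2 ℕ.+ toℕ (rank x) →
      ∃₂ λ z₁ z₂ → ¬ (z₁ ≈ z₂) ×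
        z₁ ∈ StrictlyBetween x y × z₂ ∈ StrictlyBetween x y ×
        (∀ z → z ∈ StrictlyBetween x y → z ≈ z₁ ⊎ z ≈ z₂)

-- A regular n-polytope with a base flag Φ₀ and the distinguished generators of
-- its automorphism group: s i maps Φ₀ to the flag that is i-adjacent to it.
record RegularPolytope (n : ℕ) (c ℓ₁ ℓ₂ : Level) : Set (lsuc (c ⊔ ℓ₁ ⊔ ℓ₂)) where
  field
    gradedPoset : GradedPoset n c ℓ₁ ℓ₂
    isPolytope  : IsPolytope gradedPoset
  open GradedPoset gradedPoset public using (AutGroup; poset)
  field
    flagTransitive : ∀ (Φ Φ′ : Flag gradedPoset) →
                     ∃ λ α → Φ ·ᶠ α ≈ᶠ Φ′
    Φ₀             : Flag gradedPoset
    s              : Fin n → Automorphism poset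
    s-adjacent     : ∀ i → DifferOnlyAt i Φ₀ (Φ₀ ·ᶠ s i)
    s-generate     : ∀ α → α ∈ ⟨_⟩ AutGroup s

------------------------------------------------------------------------
-- Quotients: faces are the orbits of N, represented by faces of P, and
-- x N ≤ y N when some x′ ∈ x N and y′ ∈ y N satisfy x′ ≤ y′.

module _ (P : GradedPoset n c ℓ₁ ℓ₂) (N : Subgroup (GradedPoset.AutGroup P) p) where
  open GradedPoset P
  open Subgroup N
  private
    module W = Group AutGroup

  infix 4 _≈ᴺ_ _≤ᴺ_

  _≈ᴺ_ : Rel Carrier (c ⊔ ℓ₁ ⊔ ℓ₂ ⊔ p)
  x ≈ᴺ y = ∃ λ g → g ∈ member × x · g ≈ y

  _≤ᴺ_ : Rel Carrier (c ⊔ ℓ₁ ⊔ ℓ₂ ⊔ p)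
  x ≤ᴺ y = ∃₂ λ g h → g ∈ member × h ∈ member × x · g ≤ y · h

  private
    open Automorphism using (cong; mono)

    ≈ᴺ-refl : ∀ {x} → x ≈ᴺ x
    ≈ᴺ-refl = W.ε , ε-mem , Eq.refl

    ≈ᴺ-sym : ∀ {x y} → x ≈ᴺ y → y ≈ᴺ x
    ≈ᴺ-sym {x} (g , g∈ , e) = g W.⁻¹ , ⁻¹-mem g∈ ,
      Eq.trans (cong (g W.⁻¹) (Eq.sym e)) (W.inverseʳ g x)

    ≈ᴺ-trans : ∀ {x y z} → x ≈ᴺ y → y ≈ᴺ z → x ≈ᴺ z
    ≈ᴺ-trans (g , g∈ , e) (h , h∈ , f) =
      g W.∙ h , ∙-mem g∈ h∈ , Eq.trans (cong h e) f

    ≤ᴺ-reflexive : ∀ {x y} → x ≈ᴺ y → x ≤ᴺ y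
    ≤ᴺ-reflexive (g , g∈ , e) = g , W.ε , g∈ , ε-mem , reflexive e

    ≤⇒≤ᴺ : ∀ {x y} → x ≤ y → x ≤ᴺ y
    ≤⇒≤ᴺ x≤y = W.ε , W.ε , ε-mem , ε-mem , x≤y

    normalise : ∀ {x y} → x ≤ᴺ y → ∃ λ g → g ∈ member × x · g ≤ y
    normalise {y = y} (g , h , g∈ , h∈ , le) =
      g W.∙ h W.⁻¹ , ∙-mem g∈ (⁻¹-mem h∈) ,
      trans (mono (h W.⁻¹) le) (reflexive (W.inverseʳ h y))

    ≤ᴺ-trans : ∀ {x y z} → x ≤ᴺ y → y ≤ᴺ z → x ≤ᴺ z
    ≤ᴺ-trans x≤y y≤z with normalise x≤y | normalise y≤z
    ... | g , g∈ , le | h , h∈ , le′ =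
      g W.∙ h , W.ε , ∙-mem g∈ h∈ , ε-mem , trans (mono h le) le′

    ≤ᴺ-rank : ∀ {x y} → x ≤ᴺ y → rank x Fin.≤ rank y
    ≤ᴺ-rank {x} {y} (g , h , _ , _ , le) =
      ≡.subst₂ Fin._≤_ (rank-· g x) (rank-· h y) (rank-mono le)

    ≤ᴺ-strict : ∀ {x y} → x ≤ᴺ y → rank x ≡ rank y → x ≈ᴺ y
    ≤ᴺ-strict {x} x≤y e with normalise x≤y
    ... | g , g∈ , le = g , g∈ , rank-strict le (≡.trans (rank-· g x) e)

    orbitPoset : Poset c (c ⊔ ℓ₁ ⊔ ℓ₂ ⊔ p) (c ⊔ ℓ₁ ⊔ ℓ₂ ⊔ p)
    orbitPoset = record
      { Carrier = Carrier
      ; _≈_ = _≈ᴺ_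
      ; _≤_ = _≤ᴺ_
      ; isPartialOrder = record
        { isPreorder = record
          { isEquivalence = record
            { refl = ≈ᴺ-refl ; sym = ≈ᴺ-sym ; trans = ≈ᴺ-trans }
          ; reflexive = ≤ᴺ-reflexive
          ; trans = ≤ᴺ-trans
          }
        ; antisym = λ x≤y y≤x →
            ≤ᴺ-strict x≤y (Finₚ.≤-antisym (≤ᴺ-rank x≤y) (≤ᴺ-rank y≤x))
        }
      }

    ≤ᴺ-graded : ∀ {x y} → x ≤ᴺ y → ∀ j → rank x Fin.≤ j → j Fin.≤ rank y →
                ∃ λ z → rank z ≡ j × x ≤ᴺ z × z ≤ᴺ y
    ≤ᴺ-graded {x} x≤y j lo hi with normalise x≤y
    ... | g , g∈ , le with graded le j (≡.subst (Fin._≤ j) (≡.sym (rank-· g x)) lo) hi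
    ...   | z , rz , l₁ , l₂ =
      z , rz , (g , W.ε , g∈ , ε-mem , l₁) , ≤⇒≤ᴺ l₂

  infixl 7 _/_
  _/_ : GradedPoset n c (c ⊔ ℓ₁ ⊔ ℓ₂ ⊔ p) (c ⊔ ℓ₁ ⊔ ℓ₂ ⊔ p)
  _/_ = record
    { poset       = orbitPoset
    ; rank        = rank
    ; rank-mono   = ≤ᴺ-rank
    ; rank-strict = ≤ᴺ-strict
    ; ⊥           = ⊥
    ; ⊤           = ⊤
    ; minimum     = λ x → ≤⇒≤ᴺ (minimum x)
    ; maximum     = λ x → ≤⇒≤ᴺ (maximum x)
    ; rank-⊥      = rank-⊥
    ; rank-⊤      = rank-⊤
    ; graded      = ≤ᴺ-graded
    }

------------------------------------------------------------------------
-- Flag actions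

-- `^-unique` is the constructive form of "Φ ^ s i is the only flag that differs
-- from Φ exactly in its face of rank i": there are just two flags agreeing with
-- Φ off rank i, as in the diamond condition.
record FlagAction (W : Group c ℓ) (s : Fin n → Group.Carrier W)
                  (Q : GradedPoset n a ℓ₁ ℓ₂) : Set (c ⊔ ℓ ⊔ a ⊔ ℓ₁ ⊔ ℓ₂) where
  open Group W using (Carrier; _≈_; _∙_; ε)
  infixl 8 _^_
  field
    _^_        : Flag Q → Carrier → Flag Q
    ^-cong     : ∀ {Φ Φ′ v w} → Φ ≈ᶠ Φ′ → v ≈ w → Φ ^ v ≈ᶠ Φ′ ^ w
    ^-ε        : ∀ Φ → Φ ^ ε ≈ᶠ Φ
    ^-∙        : ∀ Φ v w → Φ ^ (v ∙ w) ≈ᶠ (Φ ^ v) ^ w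
    ^-adjacent : ∀ Φ i → DifferOnlyAt i Φ (Φ ^ s i)
    ^-unique   : ∀ Φ i Φ′ → AgreeOff i Φ Φ′ → Φ′ ≈ᶠ Φ ⊎ Φ′ ≈ᶠ Φ ^ s i

-- Flags of Q lift to flags of P, so Q inherits flag-connectedness from P.  Since
-- automorphisms commute with the flag action, one fixing Ψ fixes every flag of Q,
-- hence every face.  As Ψ ^ (w ψ) = Ψ (w φ), it follows that w ψ ∈ N iff w = 1.
-- An x ∈ N lies in the coset V μ of some μ ∈ T, which is then in N, so
-- x μ⁻¹ ∈ N ∩ V is such a w ψ.
module Submission where

open import Defs
open import Algebra.Bundles using (Group)
open import Algebra.Morphism.Structures using (IsGroupHomomorphism; IsGroupIsomorphism)
import Algebra.Properties.Group as GroupProperties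
open import Data.Fin.Base as Fin using (Fin; zero; suc; inject₁)
import Data.Fin.Properties as Finₚ
open import Data.List.Base using ([]; _∷_; _++_)
open import Data.Nat.Base as ℕ using (ℕ)
import Data.Nat.Properties as ℕₚ
open import Data.Product.Base using (∃; _×_; _,_; proj₁; proj₂)
open import Data.Sum.Base using (_⊎_; inj₁; inj₂)
open import Function.Bundles using (_⇔_; mk⇔; Equivalence)
open import Function.Properties.Equivalence using (⇔-isEquivalence)
open import Level using (Level; _⊔_)
open import Relation.Binary.Bundles using (Setoid)
open import Relation.Binary.Construct.Closure.Equivalence as EqC using (EqClosure)
open import Relation.Binary.Core using (Rel)
import Relation.Binary.PropositionalEquality.Core as ≡
import Relation.Binary.Reasoning.Setoid as SetoidReasoning
open import Relation.Nullary.Decidable using (yes; no)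
open import Relation.Nullary.Negation.Core using (contradiction)
open import Relation.Unary using (Pred; _∈_; _∩_; _≬_; _≐_; ⋃)

private
  variable
    a c c′ ℓ ℓ′ ℓ₁ p t : Level
    k : ℕ

-- Words evaluated in reverse order, and the subgroup they exhaust.

module _ (G : Group c ℓ) (g : Fin k → Group.Carrier G) where
  open Group G
  open GroupProperties G using (⁻¹-anti-homo-∙; ε⁻¹≈ε; ⁻¹-involutive)

  evalᵒᵖ-++ : ∀ u w → evalᵒᵖ G g (u ++ w) ≈ evalᵒᵖ G g w ∙ evalᵒᵖ G g u
  evalᵒᵖ-++ []      w = sym (identityʳ _)
  evalᵒᵖ-++ (l ∷ u) w = trans (∙-congʳ (evalᵒᵖ-++ u w)) (assoc _ _ _)

  letter-⁻¹ : ∀ l → ∃ λ l′ → letter G g l′ ≈ letter G g l ⁻¹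
  letter-⁻¹ (i ⁺) = i ⁻ , refl
  letter-⁻¹ (i ⁻) = i ⁺ , sym (⁻¹-involutive _)

  evalᵒᵖ-⁻¹ : ∀ w → ∃ λ w′ → evalᵒᵖ G g w′ ≈ evalᵒᵖ G g w ⁻¹
  evalᵒᵖ-⁻¹ []      = [] , sym ε⁻¹≈ε
  evalᵒᵖ-⁻¹ (l ∷ w) with letter-⁻¹ l | evalᵒᵖ-⁻¹ w
  ... | l′ , e | w′ , e′ = w′ ++ l′ ∷ [] , trans (evalᵒᵖ-++ w′ (l′ ∷ []))
    (trans (∙-cong (trans (identityˡ _) e) e′) (sym (⁻¹-anti-homo-∙ _ _)))

  -- Makes every element of `V` an image under `ψ`. Products correspond to concatenation in the
  -- opposite order, and the formal inverse letters take care of inverses.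
  generated⇒evalᵒᵖ : ∀ {x} → ⟨ G ⟩ g x → ∃ λ w → x ≈ evalᵒᵖ G g w
  generated⇒evalᵒᵖ (gen i) = i ⁺ ∷ [] , sym (identityˡ _)
  generated⇒evalᵒᵖ unit = [] , refl
  generated⇒evalᵒᵖ (mul x∈ y∈) with generated⇒evalᵒᵖ x∈ | generated⇒evalᵒᵖ y∈
  ... | u , e | w , e′ = w ++ u , trans (∙-cong e e′) (sym (evalᵒᵖ-++ w u))
  generated⇒evalᵒᵖ (inv x∈) with generated⇒evalᵒᵖ x∈
  ... | w , e with evalᵒᵖ-⁻¹ w
  ...   | w′ , e′ = w′ , trans (⁻¹-cong e) (sym e′)
  generated⇒evalᵒᵖ (resp x≈y x∈) with generated⇒evalᵒᵖ x∈
  ... | w , e = w , trans (sym x≈y) e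

-- Factoring elements of a subgroup along a right transversal.

module _ (G : Group c ℓ) (N : Subgroup G p) (g : Fin k → Group.Carrier G) where
  open Group G
  open GroupProperties G using (x≈z//y; y≈x\\z)
  open Subgroup N

  transversalDecomposition :
    (T : Pred Carrier t) → IsRightTransversal G (⟨ G ⟩ g) T →
    (∀ μ → μ ∈ T → member ≬ RightCoset G (⟨ G ⟩ g) μ → μ ∈ member) →
    ∀ x → x ∈ member →
    ∃ λ μ → μ ∈ member ∩ T ×
      ∃ λ w → evalᵒᵖ G g w ∈ member × x ≈ evalᵒᵖ G g w ∙ μ
  transversalDecomposition T transversal normalised x x∈N
    with IsRightTransversal.meets transversal x
  -- `meets` places `μ` in the coset of `x`. Inverting `v` places `x` in the coset of `μ`, which is
  -- what `normalised` asks for, so the word is chosen to represent `v ⁻¹`.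
  ... | μ , μ∈T , v , v∈V , μ≈vx with generated⇒evalᵒᵖ G g (inv v∈V)
  ...   | w , v⁻¹≈w = μ , (μ∈N , μ∈T) , w ,
    resp-≈ (sym (x≈z//y _ μ x (sym x≈wμ))) (∙-mem x∈N (⁻¹-mem μ∈N)) , x≈wμ
    where
    x≈v⁻¹μ : x ≈ v ⁻¹ ∙ μ
    x≈v⁻¹μ = y≈x\\z v x μ (sym μ≈vx)

    x≈wμ : x ≈ evalᵒᵖ G g w ∙ μ
    x≈wμ = trans x≈v⁻¹μ (∙-congʳ v⁻¹≈w)

    μ∈N : μ ∈ member
    μ∈N = normalised μ μ∈T (x , x∈N , v ⁻¹ , inv v∈V , x≈v⁻¹μ)

-- Right actions of groups on setoids.

record RightAction (G : Group c ℓ) (S : Setoid a ℓ₁) : Set (c ⊔ ℓ ⊔ a ⊔ ℓ₁) where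
  open Group G using (Carrier; _≈_; _∙_; ε)
  open Setoid S using () renaming (Carrier to X; _≈_ to _≋_)
  infixl 7 _◂_
  field
    _◂_    : X → Carrier → X
    ◂-cong : ∀ {x y g h} → x ≋ y → g ≈ h → x ◂ g ≋ y ◂ h
    ◂-ε    : ∀ x → x ◂ ε ≋ x
    ◂-∙    : ∀ x g h → x ◂ (g ∙ h) ≋ x ◂ g ◂ h

module _ {G : Group c ℓ} {S : Setoid a ℓ₁} (A : RightAction G S) where
  open RightAction A
  open Group G using (_∙_; _⁻¹; inverseˡ; inverseʳ) renaming (refl to G-refl; sym to G-sym)
  open Setoid S
  open SetoidReasoning S

  ◂-cancelʳ : ∀ g x → x ◂ g ◂ (g ⁻¹) ≈ x
  ◂-cancelʳ g x = begin
    x ◂ g ◂ (g ⁻¹)    ≈⟨ ◂-∙ x g (g ⁻¹) ⟨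
    x ◂ (g ∙ g ⁻¹)    ≈⟨ ◂-cong refl (inverseʳ g) ⟩
    x ◂ Group.ε G     ≈⟨ ◂-ε x ⟩
    x                 ∎

  ◂-cancelˡ : ∀ g x → x ◂ (g ⁻¹) ◂ g ≈ x
  ◂-cancelˡ g x = begin
    x ◂ (g ⁻¹) ◂ g    ≈⟨ ◂-∙ x (g ⁻¹) g ⟨
    x ◂ (g ⁻¹ ∙ g)    ≈⟨ ◂-cong refl (inverseˡ g) ⟩
    x ◂ Group.ε G     ≈⟨ ◂-ε x ⟩
    x                 ∎

  -- Induction on the generation of `h`. For an inverse, `x` is rewritten as `x ◂ (u ⁻¹) ◂ u`, so
  -- that commutation with `u` at the point `x ◂ (u ⁻¹)` applies.
  commutes-generated : (f : Carrier → Carrier) → (∀ {x y} → x ≈ y → f x ≈ f y) →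
    (g : Fin k → Group.Carrier G) → (∀ i x → f x ◂ g i ≈ f (x ◂ g i)) →
    ∀ {h} → ⟨ G ⟩ g h → ∀ x → f x ◂ h ≈ f (x ◂ h)
  commutes-generated f f-cong g f-g = go
    where
    go : ∀ {h} → ⟨ G ⟩ g h → ∀ x → f x ◂ h ≈ f (x ◂ h)
    go (gen i) x = f-g i x
    go unit x = trans (◂-ε (f x)) (f-cong (sym (◂-ε x)))
    go (mul {u} {v} u∈ v∈) x = begin
      f x ◂ (u ∙ v)        ≈⟨ ◂-∙ (f x) u v ⟩
      f x ◂ u ◂ v          ≈⟨ ◂-cong (go u∈ x) G-refl ⟩
      f (x ◂ u) ◂ v        ≈⟨ go v∈ (x ◂ u) ⟩
      f (x ◂ u ◂ v)        ≈⟨ f-cong (◂-∙ x u v) ⟨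
      f (x ◂ (u ∙ v))      ∎
    go (inv {u} u∈) x = begin
      f x ◂ (u ⁻¹)                       ≈⟨ ◂-cong (f-cong (◂-cancelˡ u x)) G-refl ⟨
      f (x ◂ (u ⁻¹) ◂ u) ◂ (u ⁻¹)        ≈⟨ ◂-cong (go u∈ (x ◂ (u ⁻¹))) G-refl ⟨
      f (x ◂ (u ⁻¹)) ◂ u ◂ (u ⁻¹)        ≈⟨ ◂-cancelʳ u (f (x ◂ (u ⁻¹))) ⟩
      f (x ◂ (u ⁻¹))                     ∎
    go (resp {u} {v} u≈v u∈) x = begin
      f x ◂ v      ≈⟨ ◂-cong refl u≈v ⟨
      f x ◂ u      ≈⟨ go u∈ x ⟩
      f (x ◂ u)    ≈⟨ f-cong (◂-cong refl u≈v) ⟩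
      f (x ◂ v)    ∎

module _ {G : Group c ℓ} {H : Group c′ ℓ′} {S : Setoid a ℓ₁}
         (A : RightAction G S) (B : RightAction H S) where
  private
    module G = Group G
    module H = Group H
  open Setoid S
  open SetoidReasoning S
  open RightAction A
  open RightAction B using ()
    renaming (_◂_ to _⋆_; ◂-cong to ⋆-cong; ◂-ε to ⋆-ε; ◂-∙ to ⋆-∙)

  -- The second action moves past the first one and so composes in the opposite
  -- order, whence the reversal in evalᵒᵖ.
  ◂-evalᵒᵖ : (∀ x g h → (x ⋆ h) ◂ g ≈ (x ◂ g) ⋆ h) →
    (g : Fin k → G.Carrier) (h : Fin k → H.Carrier) →
    ∀ {x} → (∀ i → x ◂ g i ≈ x ⋆ h i) →
    ∀ w → x ◂ evalᵒᵖ G g w ≈ x ⋆ eval H h w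
  ◂-evalᵒᵖ comm g h {x} base = words
    where
    letters : ∀ l → x ◂ letter G g l ≈ x ⋆ letter H h l
    letters (i ⁺) = base i
    -- `base` speaks of the point `x` alone, so `h i` and its inverse are first inserted at `x`.
    -- After `base` trades `h i` for `g i`, commuting `h⁻` outwards lets `g⁻` cancel `g i`.
    letters (i ⁻) = begin
      x ◂ g⁻                  ≈⟨ ◂-cong (◂-cancelʳ B (h i) x) G.refl ⟨
      (x ⋆ h i ⋆ h⁻) ◂ g⁻     ≈⟨ ◂-cong (⋆-cong (base i) H.refl) G.refl ⟨
      ((x ◂ g i) ⋆ h⁻) ◂ g⁻   ≈⟨ comm (x ◂ g i) g⁻ h⁻ ⟩
      (x ◂ g i ◂ g⁻) ⋆ h⁻     ≈⟨ ⋆-cong (◂-cancelʳ A (g i) x) H.refl ⟩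
      x ⋆ h⁻                  ∎
      where
      g⁻ = g i G.⁻¹
      h⁻ = h i H.⁻¹

    words : ∀ w → x ◂ evalᵒᵖ G g w ≈ x ⋆ eval H h w
    words []      = trans (◂-ε x) (sym (⋆-ε x))
    words (l ∷ w) = begin
      x ◂ (evalᵒᵖ G g w G.∙ letter G g l)    ≈⟨ ◂-∙ x _ _ ⟩
      x ◂ evalᵒᵖ G g w ◂ letter G g l        ≈⟨ ◂-cong (words w) G.refl ⟩
      (x ⋆ eval H h w) ◂ letter G g l        ≈⟨ comm x _ _ ⟩
      (x ◂ letter G g l) ⋆ eval H h w        ≈⟨ ⋆-cong (letters l) H.refl ⟩
      x ⋆ letter H h l ⋆ eval H h w          ≈⟨ ⋆-∙ x _ _ ⟨
      x ⋆ (letter H h l H.∙ eval H h w)      ∎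

-- Building flags rank by rank.

module _ {n c ℓ₁ ℓ₂} (P : GradedPoset n c ℓ₁ ℓ₂) where
  open GradedPoset P
  open Flag

  -- The induction drops the lowest index. The bound `z ≤ f j` is carried along because it is the
  -- case of monotonicity that the tail cannot supply.
  chain : ∀ {p m} (C : Fin (ℕ.suc m) → Pred Carrier p) →
          (∀ j {z} → C (inject₁ j) z → ∃ λ z′ → C (suc j) z′ × z ≤ z′) →
          ∀ {z} → C zero z →
          ∃ λ (f : Fin (ℕ.suc m) → Carrier) →
            (∀ j → C j (f j)) × (∀ j → z ≤ f j) × (∀ {i j} → i Fin.≤ j → f i ≤ f j)
  chain {m = ℕ.zero} C step {z} Cz =
    (λ _ → z) , (λ { zero → Cz }) , (λ _ → refl) , (λ _ → refl)
  chain {m = ℕ.suc m} C step {z} Cz with step zero Cz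
  ... | z′ , Cz′ , z≤z′ with chain (λ j → C (suc j)) (λ j → step (suc j)) Cz′
  ...   | f′ , C′ , z′≤ , mono′ = f , Cf , z≤ , mono
    where
    f : Fin (2 ℕ.+ m) → Carrier
    f zero    = z
    f (suc j) = f′ j

    Cf : ∀ j → C j (f j)
    Cf zero    = Cz
    Cf (suc j) = C′ j

    z≤ : ∀ j → z ≤ f j
    z≤ zero    = refl
    z≤ (suc j) = trans z≤z′ (z′≤ j)

    mono : ∀ {i j} → i Fin.≤ j → f i ≤ f j
    mono {zero}  {j}     _         = z≤ j
    mono {suc i} {suc j} (ℕ.s≤s le) = mono′ le

  buildFlag : ∀ {p} (C : Fin (2 ℕ.+ n) → Pred Carrier p) →
              (∀ {j z} → C j z → rank z ≡.≡ j) →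
              (∀ j {z} → C (inject₁ j) z → ∃ λ z′ → C (suc j) z′ × z ≤ z′) →
              ∃ (C zero) → ∃ λ (Φ : Flag P) → ∀ j → C j (face Φ j)
  buildFlag C C-rank step (_ , Cz) with chain C step Cz
  ... | f , Cf , _ , mono = record
    { face = f ; rank-face = λ j → C-rank (Cf j) ; face-mono = mono } , Cf

  -- The ascent keeps every face comparable with `x`; maximality of the resulting flag then forces
  -- `x` into it.
  flagThrough : ∀ x → ∃ λ (Φ : Flag P) → x ≈ face Φ (rank x)
  flagThrough x = through (buildFlag C proj₁ step (⊥ , rank-⊥ , inj₂ (minimum x)))
    where
    C : Fin (2 ℕ.+ n) → Pred Carrier _
    C j z = rank z ≡.≡ j × (x ≤ z ⊎ z ≤ x)

    below : ∀ {j z} → rank z ≡.≡ inject₁ j → rank z Fin.≤ suc j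
    below {j} rz = ≡.subst (Fin._≤ suc j) (≡.sym rz)
      (ℕₚ.<⇒≤ (Finₚ.≤̄⇒inject₁< (Finₚ.≤-refl {x = j})))

    climb : ∀ j {z} → rank z ≡.≡ inject₁ j → x ≤ z →
            ∃ λ z′ → C (suc j) z′ × z ≤ z′
    climb j {z} rz x≤z with graded (maximum z) (suc j) (below rz)
      (≡.subst (suc j Fin.≤_) (≡.sym rank-⊤) (Finₚ.≤fromℕ (suc j)))
    ... | z′ , rz′ , z≤z′ , _ = z′ , (rz′ , inj₁ (trans x≤z z≤z′)) , z≤z′

    step : ∀ j {z} → C (inject₁ j) z → ∃ λ z′ → C (suc j) z′ × z ≤ z′
    step j (rz , inj₁ x≤z) = climb j rz x≤z
    step j {z} (rz , inj₂ z≤x) with suc j Finₚ.≤? rank x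
    ... | yes j<x with graded z≤x (suc j) (below rz) j<x
    ...   | z′ , rz′ , z≤z′ , z′≤x = z′ , (rz′ , inj₂ z′≤x) , z≤z′
    -- The ascent has reached the rank of `x`, so `z ≤ x` is an equality and the climb continues
    -- above `x`.
    step j {z} (rz , inj₂ z≤x) | no j≮x =
      climb j rz (reflexive (Eq.sym (rank-strict z≤x
        (Finₚ.≤-antisym (rank-mono z≤x) x≤rz))))
      where
      x≤rz : rank x Fin.≤ rank z
      x≤rz = ≡.subst (rank x Fin.≤_) (≡.sym rz)
        (≡.subst (Fin.toℕ (rank x) ℕ.≤_) (≡.sym (Finₚ.toℕ-inject₁ j))
          (ℕₚ.≤-pred (ℕₚ.≰⇒> j≮x)))

    through : (∃ λ (Φ : Flag P) → ∀ j → C j (face Φ j)) →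
              ∃ λ (Φ : Flag P) → x ≈ face Φ (rank x)
    through (Φ , CΦ) = Φ , maximal Φ x (λ j → proj₂ (CΦ j))

-- Flags as a setoid, and adjacency of flags.

module _ {n c ℓ₁ ℓ₂} {P : GradedPoset n c ℓ₁ ℓ₂} where
  open GradedPoset P

  flagSetoid : Setoid _ _
  flagSetoid = record
    { Carrier = Flag P
    ; _≈_ = _≈ᶠ_
    ; isEquivalence = record
      { refl  = λ _ → Eq.refl
      ; sym   = λ e j → Eq.sym (e j)
      ; trans = λ e f j → Eq.trans (e j) (f j)
      }
    }

  ·ᶠ-cong : ∀ {Φ Φ′ : Flag P} {α β} → Φ ≈ᶠ Φ′ → (∀ x → x · α ≈ x · β) →
            Φ ·ᶠ α ≈ᶠ Φ′ ·ᶠ β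
  ·ᶠ-cong {α = α} e α≈β j = Eq.trans (Automorphism.cong α (e j)) (α≈β _)

  ·ᶠ-rightAction : ∀ {c′ ℓ′} {G : Group c′ ℓ′}
    {φ : Group.Carrier G → Automorphism poset} →
    IsGroupHomomorphism (Group.rawGroup G) (Group.rawGroup AutGroup) φ →
    RightAction G flagSetoid
  ·ᶠ-rightAction {φ = φ} φ-homo = record
    { _◂_    = λ Φ g → Φ ·ᶠ φ g
    ; ◂-cong = λ {Φ} {Φ′} {g} {h} e g≈h →
        ·ᶠ-cong {Φ} {Φ′} {φ g} {φ h} e (⟦⟧-cong g≈h)
    ; ◂-ε    = λ _ _ → ε-homo _
    ; ◂-∙    = λ _ g h _ → homo g h _
    }
    where open IsGroupHomomorphism φ-homo

  -- Equality is allowed, as projection to a quotient may identify adjacent flags.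
  Adjacent : Rel (Flag P) ℓ₁
  Adjacent Φ Φ′ = Φ ≈ᶠ Φ′ ⊎ ∃ λ i → AgreeOff i Φ Φ′

FlagConnected : ∀ {n c ℓ₁ ℓ₂} → GradedPoset n c ℓ₁ ℓ₂ → Set _
FlagConnected P = ∀ (Φ Φ′ : Flag P) → EqClosure Adjacent Φ Φ′

-- Flag-connectedness of regular polytopes.

module _ {n c ℓ₁ ℓ₂} (P : RegularPolytope n c ℓ₁ ℓ₂) where
  open RegularPolytope P
  open GradedPoset gradedPoset using (module Eq)
  open Group AutGroup using (_∙_; _⁻¹; inverseʳ)

  flagConnected : FlagConnected gradedPoset
  flagConnected Φ Φ′ = EqC.transitive _ (EqC.symmetric _ (from-Φ₀ Φ)) (from-Φ₀ Φ′)
    where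
    -- Translating the adjacency of `Φ₀` and `Φ₀ ·ᶠ s i` by `γ` preserves it. Letting `γ` vary
    -- handles products: the path for `y` at `γ` is followed by the path for `x` at `y ∙ γ`.
    connect : ∀ {α} → ⟨ AutGroup ⟩ s α → ∀ γ →
              EqClosure Adjacent (Φ₀ ·ᶠ γ) (Φ₀ ·ᶠ (α ∙ γ))
    connect (gen i) γ = EqC.return
      (inj₂ (i , λ j j≢ → Automorphism.cong γ (proj₁ (s-adjacent i) j j≢)))
    connect unit γ = EqC.return (inj₁ (λ _ → Eq.refl))
    connect (mul {x} {y} x∈ y∈) γ = EqC.transitive _ (connect y∈ γ)
      (EqC.transitive _ (connect x∈ (y ∙ γ)) (EqC.return (inj₁ (λ _ → Eq.refl))))
    connect (inv {x} x∈) γ = EqC.symmetric _ (EqC.transitive _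
      (connect x∈ (x ⁻¹ ∙ γ))
      (EqC.return (inj₁ (λ j → Automorphism.cong γ (inverseʳ x _)))))
    connect (resp x≈y x∈) γ = EqC.transitive _ (connect x∈ γ)
      (EqC.return (inj₁ (λ j → Automorphism.cong γ (x≈y _))))

    from-Φ₀ : ∀ Φ → EqClosure Adjacent Φ₀ Φ
    from-Φ₀ Φ with flagTransitive Φ₀ Φ
    ... | α , e = EqC.transitive _ (EqC.return (inj₁ (λ _ → Eq.refl)))
      (EqC.transitive _ (connect (s-generate α) (Group.ε AutGroup))
        (EqC.return (inj₁ e)))

-- Lifting flags from a quotient, and connectedness of the quotient.

module _ {n c ℓ₁ ℓ₂ p} (P : GradedPoset n c ℓ₁ ℓ₂)
         (N : Subgroup (GradedPoset.AutGroup P) p) where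
  open GradedPoset P
  open Subgroup N
  private
    module W = Group AutGroup
    module Q = GradedPoset (P / N)
  open Flag

  ≈⇒≈ᴺ : ∀ {x y} → x ≈ y → x Q.≈ y
  ≈⇒≈ᴺ e = W.ε , ε-mem , e

  project : Flag P → Flag (P / N)
  project Φ = record
    { face      = face Φ
    ; rank-face = rank-face Φ
    ; face-mono = λ le → W.ε , W.ε , ε-mem , ε-mem , face-mono Φ le
    }

  project-Adjacent : ∀ {Φ Φ′ : Flag P} → Adjacent Φ Φ′ → Adjacent (project Φ) (project Φ′)
  project-Adjacent (inj₁ e)       = inj₁ (λ j → ≈⇒≈ᴺ (e j))
  project-Adjacent (inj₂ (i , e)) = inj₂ (i , λ j j≢ → ≈⇒≈ᴺ (e j j≢))

  -- Orbit representatives are corrected from the bottom upwards, each one being moved to lie above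
  -- the representative already chosen.
  liftFlag : ∀ Ψ → ∃ λ Φ → Ψ ≈ᶠ project Φ
  liftFlag Ψ = buildFlag P (λ j z → face Ψ j Q.≈ z)
    (λ {j} e → ≡.trans (≡.sym (Q.rank-cong e)) (rank-face Ψ j))
    step (face Ψ zero , Q.Eq.refl)
    where
    step : ∀ j {z} → face Ψ (inject₁ j) Q.≈ z →
           ∃ λ z′ → face Ψ (suc j) Q.≈ z′ × z ≤ z′
    step j (h , h∈ , e) with face-mono Ψ {inject₁ j} {suc j}
                               (ℕₚ.<⇒≤ (Finₚ.≤̄⇒inject₁< (Finₚ.≤-refl {x = j})))
    -- Translating `le` by `g W.⁻¹ W.∙ h` carries its lower end to the chosen `z`; its upper end is
    -- the new representative.
    ... | g , g′ , g∈ , g′∈ , le = _ ,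
      (g′ W.∙ (g W.⁻¹ W.∙ h) , ∙-mem g′∈ (∙-mem (⁻¹-mem g∈) h∈) , Eq.refl) ,
      trans (reflexive (Eq.trans (Eq.sym e)
              (Automorphism.cong h (Eq.sym (W.inverseʳ g _)))))
            (Automorphism.mono h (Automorphism.mono (g W.⁻¹) le))

  /-flagConnected : FlagConnected P → FlagConnected (P / N)
  /-flagConnected connected Ψ Ψ′ =
    EqC.transitive _ (EqC.return (inj₁ (proj₂ (liftFlag Ψ))))
      (EqC.transitive _
        (EqC.gmap project (λ {Φ} {Φ′} → project-Adjacent {Φ} {Φ′})
          (connected (proj₁ (liftFlag Ψ)) (proj₁ (liftFlag Ψ′))))
        (EqC.symmetric _ (EqC.return (inj₁ (proj₂ (liftFlag Ψ′))))))

-- Automorphisms and the flag action.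

module _ {n c ℓ a ℓ₁ ℓ₂} {W : Group c ℓ} {s : Fin n → Group.Carrier W}
         {Q : GradedPoset n a ℓ₁ ℓ₂} (action : FlagAction W s Q) where
  open FlagAction action
  open GradedPoset Q using (poset; rank; _≈_; module Eq)

  ^-rightAction : RightAction W (flagSetoid {P = Q})
  ^-rightAction = record
    { _◂_ = _^_
    ; ◂-cong = λ {Φ} {Φ′} → ^-cong {Φ} {Φ′}
    ; ◂-ε = ^-ε
    ; ◂-∙ = ^-∙
    }

  -- Off rank `i`, `(Φ ^ s i) ·ᶠ β` agrees with `Φ ·ᶠ β`, so `^-unique` leaves two candidates for
  -- it. Injectivity of `β` excludes `Φ ·ᶠ β` itself, since `Φ` and `Φ ^ s i` differ at rank `i`.
  ^-·ᶠ-gen : ∀ i Φ β → (Φ ·ᶠ β) ^ s i ≈ᶠ (Φ ^ s i) ·ᶠ β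
  ^-·ᶠ-gen i Φ β
    with ^-unique (Φ ·ᶠ β) i ((Φ ^ s i) ·ᶠ β)
           (λ j j≢ → Automorphism.cong β (proj₁ (^-adjacent Φ i) j j≢))
  ... | inj₂ e = λ j → Eq.sym (e j)
  ... | inj₁ e = contradiction
    (Automorphism.injective β (Eq.sym (e (proper i)))) (proj₂ (^-adjacent Φ i))

  ^-·ᶠ : ∀ {w} → ⟨ W ⟩ s w → ∀ Φ β → (Φ ·ᶠ β) ^ w ≈ᶠ (Φ ^ w) ·ᶠ β
  ^-·ᶠ w∈ Φ β = commutes-generated ^-rightAction (_·ᶠ β)
    (λ e j → Automorphism.cong β (e j)) s (λ i Φ → ^-·ᶠ-gen i Φ β) w∈ Φ

  Fixes : Automorphism poset → Pred (Flag Q) _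
  Fixes β Φ = Φ ·ᶠ β ≈ᶠ Φ

  fixes-resp : ∀ β {Φ Φ′} → Φ ≈ᶠ Φ′ → Fixes β Φ → Fixes β Φ′
  fixes-resp β e fix j =
    Eq.trans (Automorphism.cong β (Eq.sym (e j))) (Eq.trans (fix j) (e j))

  -- Up to equality `Φ′` is `Φ` or `Φ ^ s i`, and in the second case `β` commutes with `s i`.
  fixes-agreeOff : ∀ β {i Φ Φ′} → AgreeOff i Φ Φ′ → Fixes β Φ → Fixes β Φ′
  fixes-agreeOff β {i} {Φ} {Φ′} agree fix with ^-unique Φ i Φ′ agree
  ... | inj₁ e = fixes-resp β {Φ} {Φ′} (λ j → Eq.sym (e j)) fix
  ... | inj₂ e = fixes-resp β {Φ ^ s i} {Φ′} (λ j → Eq.sym (e j)) λ j →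
    Eq.trans (Eq.sym (^-·ᶠ-gen i Φ β j))
      (^-cong {Φ ·ᶠ β} {Φ} fix (Group.refl W) j)

  -- An equivalence, because the links of a connecting path may be traversed in either direction.
  fixes-Adjacent : ∀ β {Φ Φ′} → Adjacent Φ Φ′ → Fixes β Φ ⇔ Fixes β Φ′
  fixes-Adjacent β {Φ} {Φ′} (inj₁ e) = mk⇔ (fixes-resp β {Φ} {Φ′} e)
    (fixes-resp β {Φ′} {Φ} (λ j → Eq.sym (e j)))
  fixes-Adjacent β {Φ} {Φ′} (inj₂ (_ , agree)) =
    mk⇔ (fixes-agreeOff β {Φ = Φ} {Φ′} agree)
      (fixes-agreeOff β {Φ = Φ′} {Φ} (λ j j≢ → Eq.sym (agree j j≢)))

  fixesFlag⇒identity : FlagConnected Q → ∀ Ψ β → Fixes β Ψ → ∀ x → x · β ≈ x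
  fixesFlag⇒identity connected Ψ β fix x with flagThrough Q x
  ... | Φ , x≈ = Eq.trans (Automorphism.cong β x≈)
    (Eq.trans (Equivalence.to Ψ⇔Φ fix (rank x)) (Eq.sym x≈))
    where
    Ψ⇔Φ : Fixes β Ψ ⇔ Fixes β Φ
    Ψ⇔Φ = EqC.gfold ⇔-isEquivalence (Fixes β)
      (λ {Φ} {Φ′} → fixes-Adjacent β {Φ} {Φ′}) (connected Ψ Φ)

theorem5 :
    ∀ {c ℓ₁ ℓ₂ c′ ℓ₁′ ℓ₂′ p t : Level} {n d : ℕ}
    (P : RegularPolytope n c ℓ₁ ℓ₂) →
    let module P = RegularPolytope P
        W = P.AutGroup
        module W = Group W
    in
    (N : Subgroup W p) →
    let Q = P.gradedPoset / N
        module Q = GradedPoset Q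
        N∋ = Subgroup.member N
    in
    (action : FlagAction W P.s Q) →
    let open FlagAction action using (_^_) in
    (Ψ : Flag Q) →
    (∀ w → (w ∈ N∋) ⇔ (Ψ ^ w ≈ᶠ Ψ)) →
    (R : RegularPolytope d c′ ℓ₁′ ℓ₂′) →
    let module R = RegularPolytope R
        module AutR = Group R.AutGroup
        module AutQ = Group Q.AutGroup
        ρ = R.s
    in
    (φ : AutR.Carrier → AutQ.Carrier) →
    IsGroupIsomorphism AutR.rawGroup AutQ.rawGroup φ →
    (ν : Fin d → W.Carrier) →
    (∀ i → Ψ ^ ν i ≈ᶠ Ψ ·ᶠ φ (ρ i)) →
    let V = ⟨_⟩ W ν
        ψ = evalᵒᵖ W ν
    in
    (T : Pred W.Carrier t) →
    IsRightTransversal W V T →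
    (∀ μ → μ ∈ T → N∋ ≬ RightCoset W V μ → μ ∈ N∋) →
    N∋ ≐ ⋃ (∃ (N∋ ∩ T)) (λ (μ , _) x →
      ∃ λ w → (eval R.AutGroup ρ w AutR.≈ AutR.ε) × (x W.≈ (ψ w W.∙ μ)))
theorem5 P N action Ψ stab R φ φ-iso ν Ψ^ν T transversal normalised =
  (λ {x} → N⊆ x) , λ {x} → ⊆N x
  where
  module P = RegularPolytope P
  module R = RegularPolytope R
  module W = Group P.AutGroup
  module AutR = Group R.AutGroup
  module Q = GradedPoset (P.gradedPoset / N)
  module φ = IsGroupIsomorphism φ-iso
  module N = Subgroup N
  open FlagAction action

  evalR = eval R.AutGroup R.s
  ψ = evalᵒᵖ P.AutGroup ν

  Q-connected : FlagConnected (P.gradedPoset / N)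
  Q-connected = /-flagConnected P.gradedPoset N (flagConnected P)

  -- The flag action of `W` and the action of `Aut(R)` through `φ` commute on the flags of the
  -- quotient, and `Ψ^ν` says that they agree on generators at `Ψ`.
  Ψ^ψ : ∀ w → Ψ ^ ψ w ≈ᶠ Ψ ·ᶠ φ (evalR w)
  Ψ^ψ = ◂-evalᵒᵖ (^-rightAction action) (·ᶠ-rightAction φ.isGroupHomomorphism)
    (λ Φ w r → ^-·ᶠ action (P.s-generate w) Φ (φ r)) ν R.s {Ψ} Ψ^ν

  ψ∈N⇒eval≈ε : ∀ w → ψ w ∈ N.member → evalR w AutR.≈ AutR.ε
  -- By `stab` and `Ψ^ψ`, the automorphism `φ (evalR w)` fixes `Ψ`, so it is the identity;
  -- injectivity of `φ` brings this back to `R`.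
  ψ∈N⇒eval≈ε w ψw∈N = φ.injective λ x → Q.Eq.trans
    (fixesFlag⇒identity action Q-connected Ψ (φ (evalR w))
      (λ j → Q.Eq.trans (Q.Eq.sym (Ψ^ψ w j)) (Equivalence.to (stab (ψ w)) ψw∈N j)) x)
    (Q.Eq.sym (φ.ε-homo x))

  eval≈ε⇒ψ∈N : ∀ w → evalR w AutR.≈ AutR.ε → ψ w ∈ N.member
  eval≈ε⇒ψ∈N w w≈ε = Equivalence.from (stab (ψ w)) λ j → Q.Eq.trans (Ψ^ψ w j)
    (Q.Eq.trans (φ.⟦⟧-cong w≈ε _) (φ.ε-homo _))

  Decomposed : Pred W.Carrier _
  Decomposed = ⋃ (∃ (N.member ∩ T)) (λ (μ , _) x →
    ∃ λ w → (evalR w AutR.≈ AutR.ε) × (x W.≈ (ψ w W.∙ μ)))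

  N⊆ : ∀ x → x ∈ N.member → x ∈ Decomposed
  N⊆ x x∈N
    with transversalDecomposition P.AutGroup N ν T transversal normalised x x∈N
  ... | μ , μ∈ , w , w∈N , e = (μ , μ∈) , w , ψ∈N⇒eval≈ε w w∈N , e

  ⊆N : ∀ x → x ∈ Decomposed → x ∈ N.member
  ⊆N x ((μ , μ∈N , _) , w , w≈ε , e) = N.resp-≈ {ψ w W.∙ μ} {x}
    (W.sym {x} {ψ w W.∙ μ} e) (N.∙-mem (eval≈ε⇒ψ∈N w w≈ε) μ∈N)
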